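{- For every integer $t\geq 1$, every graph that does not contain $K^*_{3,t}$ as a minor is $3$-colourable with defect $4t$, and is $6$-colourable with clustering $2t$.
   Context: All graphs are finite and simple. $K^*_{3,t}$ denotes the complete join of $K_3$ and $\overline{K_t}$: a triangle together with $t$ pairwise non-adjacent vertices each adjacent to all three triangle vertices. A graph is $k$-colourable with defect $d$ if its vertices can be given one of $k$ colours (not necessarily properly) so that each vertex has at most $d$ neighbours of its own colour; it is $k$-colourable with clustering $c$ if its vertices can be given one of $k$ colours so that every connected component of each colour class has at most $c$ vertices. -}

module Defs where

open import Data.Nat using (ℕ; _+_; _≤_; _<ᵇ_)
open import Data.Fin using (Fin; toℕ; _≟_)
open import Data.Bool using (Bool; true; false; _∧_; _∨_; not)
open import Data.Bool.Properties using (∨-comm)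
open import Data.Maybe using (Maybe; just)
open import Data.List using (List; length; filterᵇ; allFin)
open import Data.Product using (Σ; ∃; ∃₂; _×_; _,_)
open import Relation.Nullary using (yes; no)
open import Relation.Nullary.Decidable using (⌊_⌋)
open import Relation.Binary.PropositionalEquality using (_≡_; refl; sym; cong; cong₂)

record Graph : Set where
  field
    n      : ℕ
    adj    : Fin n → Fin n → Bool
    adj-sym    : ∀ u v → adj u v ≡ adj v u
    adj-irrefl : ∀ v → adj v v ≡ false
open Graph public

data Walk (G : Graph) (P : Fin (n G) → Set) : Fin (n G) → Fin (n G) → Set where
  here : ∀ {u} → P u → Walk G P u u
  step : ∀ {u w v} → P u → adj G u w ≡ true → Walk G P w v → Walk G P u v

-- H is a minor of G: a partial map β from V(G) to V(H) whose fibres (branch sets)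
-- are nonempty and induce connected subgraphs of G, and for every edge hk of H
-- there is an edge of G between the branch sets of h and k.
record Minor (H G : Graph) : Set where
  field
    β     : Fin (n G) → Maybe (Fin (n H))
    onto  : ∀ h → ∃ λ u → β u ≡ just h
    conn  : ∀ h u v → β u ≡ just h → β v ≡ just h → Walk G (λ w → β w ≡ just h) u v
    edges : ∀ h k → adj H h k ≡ true →
            ∃₂ λ u v → β u ≡ just h × β v ≡ just k × adj G u v ≡ true

-- K*_{3,t}: vertices 0,1,2 form a triangle, vertices 3..t+2 are independent
-- and adjacent to each of 0,1,2.
eqb : ∀ {m} → Fin m → Fin m → Bool
eqb u v = ⌊ u ≟ v ⌋

private

  eqb-sym : ∀ {m} (u v : Fin m) → eqb u v ≡ eqb v u
  eqb-sym u v with u ≟ v | v ≟ u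
  ... | yes _ | yes _ = refl
  ... | no _  | no _  = refl
  ... | yes p | no q  with q (sym p)
  ... | ()
  eqb-sym u v | no q | yes p with q (sym p)
  ... | ()

  eqb-refl : ∀ {m} (u : Fin m) → eqb u u ≡ true
  eqb-refl u with u ≟ u
  ... | yes _ = refl
  ... | no q with q refl
  ... | ()

  kadj : ∀ t → Fin (3 + t) → Fin (3 + t) → Bool
  kadj t u v = ((toℕ u <ᵇ 3) ∨ (toℕ v <ᵇ 3)) ∧ not (eqb u v)

  kadj-sym : ∀ t u v → kadj t u v ≡ kadj t v u
  kadj-sym t u v = cong₂ _∧_ (∨-comm (toℕ u <ᵇ 3) (toℕ v <ᵇ 3)) (cong not (eqb-sym u v))

  kadj-irrefl : ∀ t u → kadj t u u ≡ false
  kadj-irrefl t u with eqb u u | eqb-refl u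
  ... | .true | refl with (toℕ u <ᵇ 3) ∨ (toℕ u <ᵇ 3)
  ... | true = refl
  ... | false = refl

K3t* : ℕ → Graph
K3t* t = record { n = 3 + t ; adj = kadj t ; adj-sym = kadj-sym t ; adj-irrefl = kadj-irrefl t }

DefectColourable : Graph → ℕ → ℕ → Set
DefectColourable G k d =
  Σ (Fin (n G) → Fin k) λ c →
    ∀ v → length (filterᵇ (λ u → adj G v u ∧ eqb (c u) (c v)) (allFin (n G))) ≤ d

-- G is k-colourable with clustering s: some c : V(G) → Fin k such that every
-- monochromatic component has at most s vertices, i.e. for every vertex v the set
-- of vertices joined to v by a walk all of whose vertices have colour c v has size ≤ s
-- (stated as: every duplicate-free list of such vertices has length ≤ s).
open import Data.List.Relation.Unary.All using (All)
open import Data.List.Relation.Unary.Unique.Propositional using (Unique)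

ClusterColourable : Graph → ℕ → ℕ → Set
ClusterColourable G k s =
  Σ (Fin (n G) → Fin k) λ c →
    ∀ v (xs : List (Fin (n G))) → Unique xs →
      All (λ u → Walk G (λ w → c w ≡ c v) v u) xs → length xs ≤ s

{-# OPTIONS --safe #-}
module Submission where

open import Defs
open import Data.Bool using (true; T; _∧_)
import Data.Bool.Properties as Bool
open import Data.Fin using (Fin; zero; suc; _≟_; fromℕ<; punchIn; inject≤; splitAt; join; opposite; combine)
open import Data.Fin.Properties as Fin using (any?; all?)
open import Data.Fin.Subset using (Subset; _∈_; _∉_; _⊆_; _⊂_; _⊃_; _∪_; ⁅_⁆; _-_; Nonempty; ⊤; ⊥)
open import Data.Fin.Subset.Induction using (⊂-wellFounded; ⊃-wellFounded; Acc; acc)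
open import Data.Fin.Subset.Properties using (_∈?_; nonempty?; x∈⁅x⁆; x∈⁅y⁆⇒x≡y; x∈p∪q⁺; x∈p∪q⁻;
  x∈p⇒p-x⊂p; x∈p∧x≢y⇒x∈p-y; p─q⊆p; ∈⊤; ∉⊥)
open import Data.List as List using (List; []; _∷_; length; filterᵇ; allFin)
open import Data.List.Membership.Propositional.Properties using (∈-lookup)
open import Data.List.Relation.Unary.All as All using (All; []; _∷_)
open import Data.List.Relation.Unary.All.Properties using (all-filter)
open import Data.List.Relation.Unary.AllPairs using ([]; _∷_)
open import Data.List.Relation.Unary.Unique.Propositional using (Unique)
open import Data.List.Relation.Unary.Unique.Propositional.Properties using (filter⁺; allFin⁺)
open import Data.Maybe using (Maybe; just; nothing)
open import Data.Nat as ℕ using (ℕ; zero; suc; _+_; _*_; _≤_; _<_; _⊔_; z≤n; s≤s; _≤?_)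
open import Data.Nat.Properties as ℕ using (≤-trans; ≤-reflexive; ≤-antisym; ≰⇒>; 1+n≰n; m≤m⊔n; m≤n⊔m; m≤n+m;
  +-suc; +-identityʳ; +-cancelʳ-≡; +-mono-≤; *-monoˡ-≤)
open import Data.Product using (∃; ∃₂; _×_; _,_; proj₁; proj₂)
open import Data.Sum using (_⊎_; inj₁; inj₂)
open import Data.Vec as Vec using (tabulate)
open import Data.Vec.Properties using (lookup∘tabulate; []=⇒lookup; lookup⇒[]=)
open import Function using (_∘_; id)
open import Function.Bundles using (Equivalence)
open import Relation.Binary.PropositionalEquality using (_≡_; _≢_; refl; sym; trans; cong; subst)
open import Relation.Nullary using (¬_; Dec; yes; no; does; contradiction)
open import Relation.Nullary.Decidable using (_×-dec_; _⊎-dec_; _→-dec_; ¬?; map′; dec-true; decidable-stable;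
  from-yes; toWitness)
open import Relation.Unary using (Decidable)

-- Process G piece by piece. A set C still to be coloured comes with two disjoint connected sets A and B,
-- adjacent to each other whenever C is adjacent to both; neighbours of A must avoid the colour α and
-- neighbours of B the colour β. In a component D of C choose H minimal among the connected sets that
-- contain a fixed neighbour of A, a fixed neighbour of B, and separate the neighbours of A from those
-- of B in D. H gets the third colour, and every component of D − H sees at most two of A, B, H.
--
-- Enlarge A and B by the components of D − H adjacent to them. By minimality every leaf of a spanning
-- tree of H, other than the two fixed vertices, is adjacent to both enlarged sets, so t such leaves
-- together with the enlarged A, the enlarged B and the rest of H form a K*_{3,t} minor. Hence a
-- breadth-first tree of H has at most t + 1 leaves other than its root, and each of its layers at
-- most t + 1 vertices. Layer 1 from x bounds the degree of x in H; colouring the layers from a fixed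
-- root by parity bounds the clusters.

-- Subsets of a finite set

module _ {m : ℕ} {P : Fin m → Set} (P? : Decidable P) where

  abstract
    ⟪_⟫ : Subset m
    ⟪_⟫ = tabulate (does ∘ P?)

    ∈⟪⟫⁺ : ∀ {x} → P x → x ∈ ⟪_⟫
    ∈⟪⟫⁺ {x} px = lookup⇒[]= x _ (trans (lookup∘tabulate _ x) (dec-true (P? x) px))

    ∈⟪⟫⁻ : ∀ {x} → x ∈ ⟪_⟫ → P x
    ∈⟪⟫⁻ {x} x∈ with P? x | trans (sym (lookup∘tabulate (does ∘ P?) x)) ([]=⇒lookup x∈)
    ... | yes px | _ = px

-- Elements are deleted one by one while the property survives. Minimality under single deletions
-- suffices, since it is applied to the removal of one leaf.
minimal-subset : ∀ {m} {P : Subset m → Set} → Decidable P → ∀ S → P S →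
                 ∃ λ T → T ⊆ S × P T × (∀ x → x ∈ T → ¬ P (T - x))
minimal-subset {m} {P} P? S = go S (⊂-wellFounded S)
  where
  go : ∀ S → Acc _⊂_ S → P S → ∃ λ T → T ⊆ S × P T × (∀ x → x ∈ T → ¬ P (T - x))
  go S (acc rs) pS with any? (λ x → (x ∈? S) ×-dec P? (S - x))
  ... | no ¬ex = S , id , pS , λ x x∈S p → ¬ex (x , x∈S , p)
  ... | yes (x , x∈S , p) with go (S - x) (rs (x∈p⇒p-x⊂p x∈S)) p
  ... | T , T⊆ , rest = T , (λ y∈T → p─q⊆p S ⁅ x ⁆ (T⊆ y∈T)) , rest

x∉p-x : ∀ {m} (S : Subset m) x → x ∉ S - x
x∉p-x (_ Vec.∷ S) (suc x) (Vec.there x∈) = x∉p-x S x x∈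

-- Walks and connectivity

module Walks (G : Graph) where

  V : Set
  V = Fin (n G)

  infix 4 _~_ _~ˢ_

  _~_ : V → V → Set
  u ~ v = adj G u v ≡ true

  _~?_ : ∀ u v → Dec (u ~ v)
  u ~? v = adj G u v Bool.≟ true

  ~-sym : ∀ {u v} → u ~ v → v ~ u
  ~-sym {u} {v} u~v = trans (adj-sym G v u) u~v

  ~-irrefl : ∀ {u} → ¬ (u ~ u)
  ~-irrefl {u} u~u with trans (sym u~u) (adj-irrefl G u)
  ... | ()

  _~ˢ_ : V → Subset (n G) → Set
  u ~ˢ S = ∃ λ x → x ∈ S × u ~ x

  _~ˢ?_ : ∀ u S → Dec (u ~ˢ S)
  u ~ˢ? S = any? λ x → (x ∈? S) ×-dec (u ~? x)

  Touch : Subset (n G) → Subset (n G) → Set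
  Touch S T = ∃ λ x → x ∈ S × x ~ˢ T

  touch-sym : ∀ {S T} → Touch S T → Touch T S
  touch-sym (x , x∈ , y , y∈ , x~y) = y , y∈ , x , x∈ , ~-sym x~y

  touch? : ∀ S T → Dec (Touch S T)
  touch? S T = any? λ x → (x ∈? S) ×-dec (x ~ˢ? T)

  module _ {P : V → Set} where

    walk-start : ∀ {u v} → Walk G P u v → P u
    walk-start (here p)     = p
    walk-start (step p _ _) = p

    walk-end : ∀ {u v} → Walk G P u v → P v
    walk-end (here p)     = p
    walk-end (step _ _ w) = walk-end w

    walk-snoc : ∀ {u v w} → Walk G P u v → v ~ w → P w → Walk G P u w
    walk-snoc (here p)     v~w q = step p v~w (here q)
    walk-snoc (step p e r) v~w q = step p e (walk-snoc r v~w q)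

    walk-trans : ∀ {u v w} → Walk G P u v → Walk G P v w → Walk G P u w
    walk-trans (here _)     s = s
    walk-trans (step p e r) s = step p e (walk-trans r s)

    walk-sym : ∀ {u v} → Walk G P u v → Walk G P v u
    walk-sym (here p)     = here p
    walk-sym (step p e r) = walk-snoc (walk-sym r) (~-sym e) p

  -- Each edge hands `Q` on to its next vertex. This confines a walk to a set it cannot leave.
  walk-invariant : ∀ {P Q : V → Set} → (∀ {x y} → Q x → P y → x ~ y → Q y) →
                   ∀ {u v} → Q u → Walk G P u v → Walk G Q u v
  walk-invariant cl q (here _)     = here q
  walk-invariant cl q (step _ e r) = step q e (walk-invariant cl (cl q (walk-start r) e) r)

  walk-map : ∀ {P Q : V → Set} → (∀ {x} → P x → Q x) → ∀ {u v} → Walk G P u v → Walk G Q u v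
  walk-map f (here p)     = here (f p)
  walk-map f (step p e r) = step (f p) e (walk-map f r)

  walk? : ∀ {P : V → Set} → Decidable P → ∀ s x → Dec (Walk G P s x)
  walk? {P} P? s x with P? s
  ... | no ¬ps = no (¬ps ∘ walk-start)
  ... | yes ps = saturate ⁅ s ⁆ (⊃-wellFounded _) (x∈⁅x⁆ s) (λ y∈ → subst (Walk G P s) (sym (x∈⁅y⁆⇒x≡y s y∈)) (here ps))
    where
    saturate : ∀ R → Acc _⊃_ R → s ∈ R → (∀ {y} → y ∈ R → Walk G P s y) → Dec (Walk G P s x)
    saturate R (acc rs) s∈R sound
      with any? (λ y → ((y ~ˢ? R) ×-dec P? y) ×-dec ¬? (y ∈? R))
    ... | yes (y , ((z , z∈R , y~z) , py) , y∉R) =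
      saturate (R ∪ ⁅ y ⁆) (rs ((λ u∈R → x∈p∪q⁺ (inj₁ u∈R)) , y , x∈p∪q⁺ (inj₂ (x∈⁅x⁆ y)) , y∉R))
        (x∈p∪q⁺ (inj₁ s∈R)) sound′
      where
      sound′ : ∀ {u} → u ∈ R ∪ ⁅ y ⁆ → Walk G P s u
      sound′ {u} u∈ with x∈p∪q⁻ R ⁅ y ⁆ u∈
      ... | inj₁ u∈R = sound u∈R
      ... | inj₂ u∈y = subst (Walk G P s) (sym (x∈⁅y⁆⇒x≡y y u∈y)) (walk-snoc (sound z∈R) (~-sym y~z) py)
    -- `R` has no exit through `P`, so a walk from `s` stays inside it and membership in `R`
    -- decides.
    ... | no closed = map′ sound (λ w → walk-end (walk-invariant stay s∈R w)) (x ∈? R)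
      where
      stay : ∀ {u v} → u ∈ R → P v → u ~ v → v ∈ R
      stay {u} {v} u∈R pv u~v = decidable-stable (v ∈? R)
        λ v∉R → closed (v , ((u , u∈R , ~-sym u~v) , pv) , v∉R)

  Conn : Subset (n G) → Set
  Conn S = ∀ {x y} → x ∈ S → y ∈ S → Walk G (_∈ S) x y

  conn-from : ∀ {S r} → (∀ {x} → x ∈ S → Walk G (_∈ S) x r) → Conn S
  conn-from f x∈S y∈S = walk-trans (f x∈S) (walk-sym (f y∈S))

-- Breadth-first trees

least : ∀ {P : ℕ → Set} → Decidable P → ∀ {k} → P k → ∃ λ m → P m × (∀ {j} → P j → m ≤ j)
least P? {k} pk with P? 0
... | yes p0 = 0 , p0 , λ _ → z≤n
least P? {zero}  p0 | no ¬p0 = contradiction p0 ¬p0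
least P? {suc k} pk | no ¬p0 with least (P? ∘ suc) pk
... | m , pm , min = suc m , pm , λ { {zero} p0 → contradiction p0 ¬p0 ; {suc j} pj → s≤s (min pj) }

bounded : ∀ {m} (f : Fin m → ℕ) → ∃ λ M → ∀ i → f i ≤ M
bounded {zero}  f = 0 , λ ()
bounded {suc m} f with bounded (f ∘ suc)
... | M , f≤M = f zero ⊔ M , λ { zero → m≤m⊔n _ _ ; (suc i) → ≤-trans (f≤M i) (m≤n⊔m (f zero) M) }

module BFS (G : Graph) {H : Subset (n G)} (H-conn : Walks.Conn G H) {r : Fin (n G)} (r∈H : r ∈ H) where
  open Walks G

  Within : ℕ → V → Set
  Within zero    x = x ≡ r
  Within (suc k) x = Within k x ⊎ (x ∈ H × ∃ λ y → Within k y × y ~ x)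

  within? : ∀ k → Decidable (Within k)
  within? zero    x = x ≟ r
  within? (suc k) x = within? k x ⊎-dec ((x ∈? H) ×-dec any? λ y → within? k y ×-dec (y ~? x))

  within-∈ : ∀ k {x} → Within k x → x ∈ H
  within-∈ zero    refl           = r∈H
  within-∈ (suc k) (inj₁ w)       = within-∈ k w
  within-∈ (suc k) (inj₂ (x∈ , _)) = x∈

  walk-within : ∀ {k x y} → Within k x → Walk G (_∈ H) x y → ∃ λ j → Within j y
  walk-within w (here _)     = _ , w
  walk-within {k} w (step _ e s) = walk-within {suc k} (inj₂ (walk-start s , _ , w , e)) s

  distance : ∀ x → ∃ λ k → x ∈ H → Within k x × (∀ {j} → Within j x → k ≤ j)
  distance x with x ∈? H
  -- Outside `H` the value 0 is a placeholder with a vacuous guarantee.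
  ... | no  x∉H = 0 , λ x∈H → contradiction x∈H x∉H
  ... | yes x∈H with least (λ k → within? k x) (proj₂ (walk-within {0} refl (H-conn r∈H x∈H)))
  ... | k , w , min = k , λ _ → w , min

  δ : V → ℕ
  δ x = proj₁ (distance x)

  δ-within : ∀ {x} → x ∈ H → Within (δ x) x
  δ-within {x} x∈H = proj₁ (proj₂ (distance x) x∈H)

  δ-min : ∀ {x j} → Within j x → δ x ≤ j
  δ-min {x} {j} w = proj₂ (proj₂ (distance x) (within-∈ j w)) w

  δ≡0⇒root : ∀ {x} → x ∈ H → δ x ≡ 0 → x ≡ r
  δ≡0⇒root x∈H δ≡0 = subst (λ k → Within k _) δ≡0 (δ-within x∈H)

  δ-root : δ r ≡ 0
  δ-root = ℕ.n≤0⇒n≡0 (δ-min {j = 0} refl)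

  δ-step : ∀ {x y} → x ∈ H → y ∈ H → x ~ y → δ y ≤ suc (δ x)
  δ-step x∈H y∈H x~y = δ-min (inj₂ (y∈H , _ , δ-within x∈H , x~y))

  Parent : V → V → Set
  Parent x y = y ∈ H × y ~ x × suc (δ y) ≡ δ x

  parent? : ∀ x → Dec (∃ (Parent x))
  parent? x = any? λ y → (y ∈? H) ×-dec ((y ~? x) ×-dec (suc (δ y) ℕ.≟ δ x))

  -- Take the last edge of a shortest walk from `r`: its first end has distance at most `k`, and any
  -- less would bring `x` closer than `δ x`.
  hasParent : ∀ {x} → x ∈ H → 0 < δ x → ∃ (Parent x)
  hasParent {x} x∈H 0<δ = go (δ x) refl 0<δ (δ-within x∈H)
    where
    go : ∀ k → δ x ≡ k → 0 < k → Within k x → ∃ (Parent x)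
    go (suc k) δ≡ _ (inj₁ w) = contradiction (subst (_≤ k) δ≡ (δ-min w)) 1+n≰n
    go (suc k) δ≡ _ (inj₂ (_ , y , w , y~x)) = y , y∈H , y~x ,
      ≤-antisym (≤-trans (s≤s (δ-min w)) (≤-reflexive (sym δ≡))) (δ-step y∈H x∈H y~x)
      where y∈H = within-∈ k w

  parent : V → V
  parent x with parent? x
  ... | yes (y , _) = y
  -- This default occurs only where `δ x` is 0: at the root and outside `H`.
  ... | no _        = x

  parent-spec : ∀ {x} → x ∈ H → 0 < δ x → Parent x (parent x)
  parent-spec {x} x∈H 0<δ with parent? x
  ... | yes (y , py) = py
  ... | no ¬p        = contradiction (hasParent x∈H 0<δ) ¬p

  -- The root is excluded, so cutting off leaves never removes `r`.
  Leaf : V → Set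
  Leaf ℓ = ℓ ∈ H × 0 < δ ℓ × (∀ x → x ∈ H → 0 < δ x → parent x ≢ ℓ)

  ancestor : ℕ → V → V
  ancestor zero    x = x
  ancestor (suc m) x = parent (ancestor m x)

  -- The depth equation is kept so that `ℓ` and the layer of `x` determine the number of steps `m`,
  -- and hence `x`.
  LeafBelow : V → V → Set
  LeafBelow x ℓ = Leaf ℓ × ∃ λ m → ancestor m ℓ ≡ x × δ ℓ ≡ m + δ x

  leafBelow : ∀ {x} → x ∈ H → 0 < δ x → ∃ (LeafBelow x)
  leafBelow {x} = go M (m≤n+m M (δ x))
    where
    M = proj₁ (bounded δ)

    -- Descend to a child while there is one. The fuel `f` covers the layers left up to the depth
    -- bound `M`; each descent spends one.
    go : ∀ f {x} → M ≤ δ x + f → x ∈ H → 0 < δ x → ∃ (LeafBelow x)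
    go f {x} M≤ x∈H 0<δ
      with any? (λ y → ((y ∈? H) ×-dec (0 ℕ.<? δ y)) ×-dec (parent y ≟ x))
    ... | no ¬child = x , (x∈H , 0<δ , λ y y∈H 0<δy eq → ¬child (y , (y∈H , 0<δy) , eq)) , 0 , refl , refl
    ... | yes (y , (y∈H , 0<δy) , refl) = below f M≤
      where
      δy≡ : suc (δ (parent y)) ≡ δ y
      δy≡ = proj₂ (proj₂ (parent-spec y∈H 0<δy))

      below : ∀ f → M ≤ δ (parent y) + f → ∃ (LeafBelow (parent y))
      below zero M≤ = contradiction
        (≤-trans (≤-reflexive δy≡) (≤-trans (proj₂ (bounded δ) y) (subst (M ≤_) (+-identityʳ _) M≤))) 1+n≰n
      below (suc f) M≤
        with go f (subst (M ≤_) (trans (+-suc _ f) (cong (_+ f) δy≡)) M≤) y∈H 0<δy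
      ... | ℓ , leaf , m , anc , δℓ =
        ℓ , leaf , suc m , cong parent anc , trans δℓ (trans (cong (m +_) (sym δy≡)) (+-suc m _))

  -- Climbing from `ℓ` to a given layer takes a fixed number of steps, so subtrees hanging from one
  -- layer share no leaf.
  leafBelow-injective : ∀ {x y ℓ} → δ x ≡ δ y → LeafBelow x ℓ → LeafBelow y ℓ → x ≡ y
  leafBelow-injective {x} {y} δ≡ (_ , m , ancx , ex) (_ , m′ , ancy , ey) =
    trans (sym ancx) (trans (cong (λ k → ancestor k _) m≡m′) ancy)
    where
    m≡m′ : m ≡ m′
    m≡m′ = +-cancelʳ-≡ (δ y) m m′ (trans (cong (m +_) (sym δ≡)) (trans (sym ex) ey))

  -- Climb along parents: a parent has a child, so it is no leaf and not in `Y`. Thus `H` stays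
  -- connected when any set of leaves is cut off.
  walk-avoiding-leaves : {Y : V → Set} → (∀ {x} → Y x → Leaf x) →
                         ∀ {x} → x ∈ H → ¬ Y x → Walk G (λ z → z ∈ H × ¬ Y z) x r
  walk-avoiding-leaves {Y} Y⇒leaf = go _ refl
    where
    go : ∀ k {x} → δ x ≡ k → x ∈ H → ¬ Y x → Walk G (λ z → z ∈ H × ¬ Y z) x r
    go zero δ≡ x∈H ¬Yx with δ≡0⇒root x∈H δ≡
    ... | refl = here (x∈H , ¬Yx)
    go (suc k) {x} δ≡ x∈H ¬Yx with parent-spec x∈H 0<δ
      where
      0<δ : 0 < δ x
      0<δ = subst (0 <_) (sym δ≡) (s≤s z≤n)
    ... | p∈H , p~x , δp = step (x∈H , ¬Yx) (~-sym p~x)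
      (go k (ℕ.suc-injective (trans δp δ≡)) p∈H λ Yp → proj₂ (proj₂ (Y⇒leaf Yp)) x x∈H (subst (0 <_) (sym δ≡) (s≤s z≤n)) refl)

-- Minors from branch sets

module _ {H G : Graph} (Z : Fin (n H) → Subset (n G))
  (nonempty : ∀ h → Nonempty (Z h)) (connected : ∀ h → Walks.Conn G (Z h))
  (disjoint : ∀ h k {x} → x ∈ Z h → x ∈ Z k → h ≡ k)
  (touching : ∀ h k → adj H h k ≡ true → Walks.Touch G (Z h) (Z k)) where
  open Walks G

  private
    branch : V → Maybe (Fin (n H))
    branch u with any? (λ h → u ∈? Z h)
    ... | yes (h , _) = just h
    ... | no _        = nothing

    branch⁺ : ∀ {h u} → u ∈ Z h → branch u ≡ just h
    branch⁺ {h} {u} u∈ with any? (λ h → u ∈? Z h)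
    ... | yes (k , u∈k) = cong just (disjoint k h u∈k u∈)
    ... | no ¬ex        = contradiction (h , u∈) ¬ex

    branch⁻ : ∀ {h u} → branch u ≡ just h → u ∈ Z h
    branch⁻ {h} {u} eq with any? (λ h → u ∈? Z h)
    branch⁻ refl | yes (h , u∈) = u∈

  branchSets⇒minor : Minor H G
  branchSets⇒minor = record
    { β     = branch
    ; onto  = λ h → let x , x∈ = nonempty h in x , branch⁺ x∈
    ; conn  = λ h u v u∈ v∈ → walk-map branch⁺ (connected h (branch⁻ u∈) (branch⁻ v∈))
    ; edges = λ h k hk → let x , x∈ , y , y∈ , x~y = touching h k hk
                         in x , y , branch⁺ x∈ , branch⁺ y∈ , x~y
    }

module _ {G : Graph} {t : ℕ} (K : Fin 3 → Subset (n G)) (ℓ : Fin t → Fin (n G))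
  (nonempty : ∀ h → Nonempty (K h)) (connected : ∀ h → Walks.Conn G (K h))
  (disjoint : ∀ h k {x} → x ∈ K h → x ∈ K k → h ≡ k)
  (touching : ∀ h k → h ≢ k → Walks.Touch G (K h) (K k))
  (ℓ-injective : ∀ {i j} → ℓ i ≡ ℓ j → i ≡ j)
  (ℓ∉ : ∀ i h → ℓ i ∉ K h) (ℓ~ : ∀ i h → Walks._~ˢ_ G (ℓ i) (K h)) where
  open Walks G

  private
    part : Fin 3 ⊎ Fin t → Subset (n G)
    part (inj₁ h) = K h
    part (inj₂ i) = ⁅ ℓ i ⁆

    part-nonempty : ∀ p → Nonempty (part p)
    part-nonempty (inj₁ h) = nonempty h
    part-nonempty (inj₂ i) = ℓ i , x∈⁅x⁆ _

    part-connected : ∀ p → Conn (part p)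
    part-connected (inj₁ h) = connected h
    part-connected (inj₂ i) x∈ y∈ with x∈⁅y⁆⇒x≡y _ x∈ | x∈⁅y⁆⇒x≡y _ y∈
    ... | refl | refl = here x∈

    part-disjoint : ∀ p q {x} → x ∈ part p → x ∈ part q → p ≡ q
    part-disjoint (inj₁ h) (inj₁ k) x∈ y∈ = cong inj₁ (disjoint h k x∈ y∈)
    part-disjoint (inj₁ h) (inj₂ j) x∈ y∈ with refl ← x∈⁅y⁆⇒x≡y _ y∈ = contradiction x∈ (ℓ∉ j h)
    part-disjoint (inj₂ i) (inj₁ k) x∈ y∈ with refl ← x∈⁅y⁆⇒x≡y _ x∈ = contradiction y∈ (ℓ∉ i k)
    part-disjoint (inj₂ i) (inj₂ j) x∈ y∈ =
      cong inj₂ (ℓ-injective (trans (sym (x∈⁅y⁆⇒x≡y _ x∈)) (x∈⁅y⁆⇒x≡y _ y∈)))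

    Z : Fin (3 + t) → Subset (n G)
    Z h = part (splitAt 3 h)

    Z-disjoint : ∀ h k {x} → x ∈ Z h → x ∈ Z k → h ≡ k
    Z-disjoint h k x∈ y∈ = trans (sym (Fin.join-splitAt 3 t h))
      (trans (cong (join 3 t) (part-disjoint (splitAt 3 h) (splitAt 3 k) x∈ y∈)) (Fin.join-splitAt 3 t k))

    Z-touching : ∀ h k → adj (K3t* t) h k ≡ true → Touch (Z h) (Z k)
    Z-touching h k hk with splitAt 3 h in eh | splitAt 3 k in ek
    ... | inj₁ a | inj₁ b = touching a b λ { refl →
      Walks.~-irrefl (K3t* t) {k} (subst (λ x → adj (K3t* t) x k ≡ true)
        (trans (sym (Fin.splitAt⁻¹-↑ˡ {i = h} eh)) (Fin.splitAt⁻¹-↑ˡ {i = k} ek)) hk) }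
    ... | inj₁ a | inj₂ j = touch-sym (_ , x∈⁅x⁆ _ , ℓ~ j a)
    ... | inj₂ i | inj₁ b = _ , x∈⁅x⁆ _ , ℓ~ i b
    -- Both indices are at least 3, so `kadj` evaluates to `false` and there is no edge to realise.
    ... | inj₂ i | inj₂ j with refl ← Fin.splitAt⁻¹-↑ʳ {m = 3} {i = h} eh | refl ← Fin.splitAt⁻¹-↑ʳ {m = 3} {i = k} ek
      with () ← hk

  K3t*-minor : Minor (K3t* t) G
  K3t*-minor = branchSets⇒minor Z (λ h → part-nonempty (splitAt 3 h))
    (λ h → part-connected (splitAt 3 h)) Z-disjoint Z-touching

-- Injective selections

lookup-injective : ∀ {A : Set} {xs : List A} → Unique xs → ∀ {i j} → List.lookup xs i ≡ List.lookup xs j → i ≡ j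
lookup-injective (_ ∷ _)  {zero}  {zero}  _  = refl
lookup-injective (x∉ ∷ _) {zero}  {suc j} eq = contradiction eq (All.lookup x∉ (∈-lookup j))
lookup-injective (x∉ ∷ _) {suc i} {zero}  eq = contradiction (sym eq) (All.lookup x∉ (∈-lookup i))
lookup-injective (_ ∷ u)  {suc i} {suc j} eq = cong suc (lookup-injective u eq)

dodge : ∀ {A : Set} (_≟A_ : ∀ (x y : A) → Dec (x ≡ y)) {m} (f : Fin (suc m) → A) → (∀ {i j} → f i ≡ f j → i ≡ j) → ∀ a →
        ∃ λ (σ : Fin m → Fin (suc m)) → (∀ {i j} → σ i ≡ σ j → i ≡ j) × (∀ i → f (σ i) ≢ a)
dodge _≟A_ f f-inj a with any? (λ i → f i ≟A a)
... | yes (i , refl) = punchIn i , Fin.punchIn-injective i _ _ , λ j eq → Fin.punchInᵢ≢i i j (f-inj eq)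
-- `a` is never hit; index 0 is dropped merely to get the right size.
... | no ¬ex         = suc , Fin.suc-injective , λ i eq → ¬ex (suc i , eq)

-- The two spare indices pay for the two fixed vertices of `H`, which may not be used as leaves.
dodge₂ : ∀ {A : Set} (_≟A_ : ∀ (x y : A) → Dec (x ≡ y)) {m} (f : Fin (2 + m) → A) → (∀ {i j} → f i ≡ f j → i ≡ j) → ∀ a b →
         ∃ λ (σ : Fin m → Fin (2 + m)) → (∀ {i j} → σ i ≡ σ j → i ≡ j) × (∀ i → f (σ i) ≢ a) × (∀ i → f (σ i) ≢ b)
dodge₂ _≟A_ f f-inj a b with dodge _≟A_ f f-inj a
... | σ , σ-inj , ≢a with dodge _≟A_ (f ∘ σ) (λ eq → σ-inj (f-inj eq)) b
... | τ , τ-inj , ≢b = σ ∘ τ , (λ eq → τ-inj (σ-inj eq)) , (λ i → ≢a (τ i)) , ≢b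

-- Enlarging a set by adjacent components

module Halo (G : Graph) {Q : Fin (n G) → Set} (Q? : Decidable Q) (A : Subset (n G)) where
  open Walks G

  Reached : V → Set
  Reached z = ∃ λ y → y ~ˢ A × Walk G Q y z

  private
    InHalo : V → Set
    InHalo z = z ∈ A ⊎ Reached z

    inHalo? : Decidable InHalo
    inHalo? z = (z ∈? A) ⊎-dec any? λ y → (y ~ˢ? A) ×-dec walk? Q? y z

  halo : Subset (n G)
  halo = ⟪ inHalo? ⟫

  halo⁺ : ∀ {z} → z ∈ A ⊎ Reached z → z ∈ halo
  halo⁺ = ∈⟪⟫⁺ inHalo?

  halo⁻ : ∀ {z} → z ∈ halo → z ∈ A ⊎ Reached z
  halo⁻ = ∈⟪⟫⁻ inHalo?

  halo-closed : ∀ {u} → Q u → u ~ˢ halo → u ∈ halo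
  halo-closed {u} qu (z , z∈ , u~z) with halo⁻ z∈
  ... | inj₁ z∈A            = halo⁺ (inj₂ (u , (z , z∈A , u~z) , here qu))
  ... | inj₂ (y , y~A , w) = halo⁺ (inj₂ (y , y~A , walk-snoc w (~-sym u~z) qu))

  -- A vertex outside `A` retraces its walk to the entry vertex `y`, staying in the halo, and steps
  -- into `A`; there `A` itself provides the connection.
  halo-conn : Conn A → Conn halo
  halo-conn A-conn x∈ y∈ with toA x∈ | toA y∈
    where
    toA : ∀ {x} → x ∈ halo → ∃ λ a → a ∈ A × Walk G (_∈ halo) x a
    toA {x} x∈ with halo⁻ x∈
    ... | inj₁ x∈A = x , x∈A , here x∈
    ... | inj₂ (y , (a , a∈A , y~a) , w) = a , a∈A , walk-snoc (walk-sym inside-halo) y~a (halo⁺ (inj₁ a∈A))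
      where
      inside-halo : Walk G (_∈ halo) y x
      inside-halo = walk-invariant (λ u∈ qv u~v → halo-closed qv (_ , u∈ , ~-sym u~v))
        (halo-closed (walk-start w) (a , halo⁺ (inj₁ a∈A) , y~a)) w
  ... | a , a∈A , v | b , b∈A , w =
    walk-trans v (walk-trans (walk-map (halo⁺ ∘ inj₁) (A-conn a∈A b∈A)) (walk-sym w))

  -- Until its first visit to `ℓ` the walk is absorbed by the halo vertex by vertex; on that visit
  -- `ℓ` is seen to be adjacent to the halo.
  halo-crossing : ∀ {ℓ u v} → u ~ˢ halo → Walk G (λ z → Q z ⊎ z ≡ ℓ) u v → v ∈ halo ⊎ ℓ ~ˢ halo
  halo-crossing u~ (here (inj₁ qu))   = inj₁ (halo-closed qu u~)
  halo-crossing u~ (here (inj₂ refl)) = inj₂ u~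
  halo-crossing u~ (step (inj₁ qu) e w)   = halo-crossing (_ , halo-closed qu u~ , ~-sym e) w
  halo-crossing u~ (step (inj₂ refl) e w) = inj₂ u~

-- Minimal connected separators

module Pieces (G : Graph) {t : ℕ} (1≤t : 1 ≤ t) (minor-free : ¬ Minor (K3t* t) G) where
  open Walks G

  record Frame (C A B : Subset (n G)) : Set where
    field
      A-conn : Conn A
      B-conn : Conn B
      A∌B    : ∀ {x} → x ∈ A → x ∉ B
      C∌A    : ∀ {x} → x ∈ C → x ∉ A
      C∌B    : ∀ {x} → x ∈ C → x ∉ B
      joined : Touch C A → Touch C B → Touch A B

  -- `thin` ranges over all roots: degrees use the tree rooted at the vertex in question, clusters
  -- the one rooted at `root`. Layer 0 is just the root.
  record Piece (D A B : Subset (n G)) : Set where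
    field
      H         : Subset (n G)
      H⊆D       : H ⊆ D
      root      : V
      root∈     : root ∈ H
      H-conn    : Conn H
      meets-A   : Touch D A → Touch H A
      meets-B   : Touch D B → Touch H B
      separates : ∀ {x y} → x ~ˢ A → y ~ˢ B → ¬ Walk G (λ z → z ∈ D × z ∉ H) x y
      thin      : ∀ {r} (r∈H : r ∈ H) k {xs} → Unique xs →
                  All (λ x → x ∈ H × BFS.δ G H-conn r∈H x ≡ suc k) xs → length xs ≤ suc t

  Outside : Subset (n G) → Subset (n G) → V → Set
  Outside D T z = z ∈ D × z ∉ T

  outside? : ∀ D T → Decidable (Outside D T)
  outside? D T z = (z ∈? D) ×-dec ¬? (z ∈? T)

  -- Failure of `T` to separate. The walk may be a single vertex adjacent to both sets.
  Leak : Subset (n G) → Subset (n G) → Subset (n G) → Subset (n G) → Set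
  Leak D A B T = ∃₂ λ x y → (x ~ˢ A × y ~ˢ B) × Walk G (Outside D T) x y

  leak? : ∀ D A B → Decidable (Leak D A B)
  leak? D A B T = any? λ x → any? λ y → ((x ~ˢ? A) ×-dec (y ~ˢ? B)) ×-dec walk? (outside? D T) x y

  module Minimal {D A B : Subset (n G)} (frame : Frame D A B) {H : Subset (n G)} (H⊆D : H ⊆ D) (H-conn : Conn H)
    {a b : V} (a∈H : a ∈ H) (b∈H : b ∈ H) (a~A : Touch D A → a ~ˢ A) (b~B : Touch D B → b ~ˢ B)
    (tight : ¬ Leak D A B H)
    (irreducible : ∀ {ℓ} → ℓ ∈ H → ℓ ≢ a → ℓ ≢ b → Conn (H - ℓ) → Leak D A B (H - ℓ)) where
    open Frame frame

    private
      open Halo G (outside? D H) A using () renaming (halo to A⁺; halo⁺ to A⁺⁺; halo⁻ to A⁺⁻;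
        halo-conn to A⁺-conn; halo-crossing to A⁺-crossing)
      open Halo G (outside? D H) B using () renaming (halo to B⁺; halo⁺ to B⁺⁺; halo⁻ to B⁺⁻;
        halo-conn to B⁺-conn; halo-crossing to B⁺-crossing)

      ¬leak : ∀ {x y} → x ~ˢ A → y ~ˢ B → ¬ Walk G (Outside D H) x y
      ¬leak x~A y~B w = tight (_ , _ , (x~A , y~B) , w)

      A⁺-B⁺-disjoint : ∀ {x} → x ∈ A⁺ → x ∉ B⁺
      A⁺-B⁺-disjoint x∈ x∈′ with A⁺⁻ x∈ | B⁺⁻ x∈′
      ... | inj₁ x∈A | inj₁ x∈B = A∌B x∈A x∈B
      ... | inj₁ x∈A | inj₂ (_ , _ , w) = C∌A (proj₁ (walk-end w)) x∈A
      ... | inj₂ (_ , _ , w) | inj₁ x∈B = C∌B (proj₁ (walk-end w)) x∈B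
      ... | inj₂ (_ , y~A , v) | inj₂ (_ , z~B , w) = ¬leak y~A z~B (walk-trans v (walk-sym w))

      H∌A⁺ : ∀ {x} → x ∈ H → x ∉ A⁺
      H∌A⁺ x∈H x∈ with A⁺⁻ x∈
      ... | inj₁ x∈A = C∌A (H⊆D x∈H) x∈A
      ... | inj₂ (_ , _ , w) = proj₂ (walk-end w) x∈H

      H∌B⁺ : ∀ {x} → x ∈ H → x ∉ B⁺
      H∌B⁺ x∈H x∈ with B⁺⁻ x∈
      ... | inj₁ x∈B = C∌B (H⊆D x∈H) x∈B
      ... | inj₂ (_ , _ , w) = proj₂ (walk-end w) x∈H

      -- The contacts of `D` with `A` and `B` are recorded because they release `joined`, `a~A` and
      -- `b~B`, the edges of the triangle in the minor.
      record Essential (ℓ : V) : Set where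
        field
          ~A⁺     : ℓ ~ˢ A⁺
          ~B⁺     : ℓ ~ˢ B⁺
          touch-A : Touch D A
          touch-B : Touch D B

      module _ {r : V} (r∈H : r ∈ H) where
        open BFS G H-conn r∈H

        -- The rest of the tree still connects `H - ℓ`, so what fails must be separation.
        leaf-leak : ∀ {ℓ} → Leaf ℓ → ℓ ≢ a → ℓ ≢ b → Leak D A B (H - ℓ)
        leaf-leak {ℓ} leaf ℓ≢a ℓ≢b = irreducible (proj₁ leaf) ℓ≢a ℓ≢b (conn-from toRoot)
          where
          toRoot : ∀ {x} → x ∈ H - ℓ → Walk G (_∈ H - ℓ) x r
          toRoot x∈ = walk-map (λ { (z∈H , z≢ℓ) → x∈p∧x≢y⇒x∈p-y z∈H z≢ℓ })
            (walk-avoiding-leaves {Y = _≡ ℓ} (λ { refl → leaf }) (p─q⊆p H ⁅ ℓ ⁆ x∈) λ { refl → x∉p-x H _ x∈ })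

        -- `H` separates, so the leak runs through `ℓ`. Up to `ℓ` it stays in `A⁺`, and read
        -- backwards in `B⁺`; its ends show that `D` touches both sets.
        leaf-essential : ∀ {ℓ} → Leaf ℓ → ℓ ≢ a → ℓ ≢ b → Essential ℓ
        leaf-essential {ℓ} leaf ℓ≢a ℓ≢b with leaf-leak leaf ℓ≢a ℓ≢b
        ... | x , y , (x~A , y~B) , w = record
          { ~A⁺     = reachA (A⁺-crossing (lift A⁺⁺ x~A) w′)
          ; ~B⁺     = reachB (B⁺-crossing (lift B⁺⁺ y~B) (walk-sym w′))
          ; touch-A = x , proj₁ (walk-start w) , x~A
          ; touch-B = y , proj₁ (walk-end w) , y~B
          }
          where
          lift : ∀ {x S S⁺} {P : V → Set} → (∀ {z} → z ∈ S ⊎ P z → z ∈ S⁺) → x ~ˢ S → x ~ˢ S⁺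
          lift inc (z , z∈ , x~z) = z , inc (inj₁ z∈) , x~z

          w′ : Walk G (λ z → Outside D H z ⊎ z ≡ ℓ) x y
          w′ = walk-map f w
            where
            f : ∀ {z} → Outside D (H - ℓ) z → Outside D H z ⊎ z ≡ ℓ
            f {z} (z∈D , z∉) with z ≟ ℓ
            ... | yes z≡ℓ = inj₂ z≡ℓ
            ... | no  z≢ℓ = inj₁ (z∈D , λ z∈H → z∉ (x∈p∧x≢y⇒x∈p-y z∈H z≢ℓ))

          reachA : y ∈ A⁺ ⊎ ℓ ~ˢ A⁺ → ℓ ~ˢ A⁺
          reachA (inj₂ ℓ~) = ℓ~
          -- Here `y`, a neighbour of `B`, would lie in `A` or be reached from `A` without entering
          -- `H`.
          reachA (inj₁ y∈) with A⁺⁻ y∈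
          ... | inj₁ y∈A = contradiction y∈A (C∌A (proj₁ (walk-end w)))
          ... | inj₂ (_ , z~A , v) = contradiction v (¬leak z~A y~B)

          reachB : x ∈ B⁺ ⊎ ℓ ~ˢ B⁺ → ℓ ~ˢ B⁺
          reachB (inj₂ ℓ~) = ℓ~
          reachB (inj₁ x∈) with B⁺⁻ x∈
          ... | inj₁ x∈B = contradiction x∈B (C∌B (proj₁ (walk-start w)))
          ... | inj₂ (_ , z~B , v) = contradiction (walk-sym v) (¬leak x~A z~B)

        module _ (ℓ : Fin t → V) (ℓ-injective : ∀ {i j} → ℓ i ≡ ℓ j → i ≡ j)
                 (leaf : ∀ i → Leaf (ℓ i)) (ℓ≢a : ∀ i → ℓ i ≢ a) (ℓ≢b : ∀ i → ℓ i ≢ b) where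

          private
            IsLeaf : V → Set
            IsLeaf z = ∃ λ i → ℓ i ≡ z

            core? : Decidable (λ z → z ∈ H × ¬ IsLeaf z)
            core? z = (z ∈? H) ×-dec ¬? (any? λ i → ℓ i ≟ z)

            -- The third hub: the tree without the chosen leaves. It keeps `a` and `b`, through
            -- which it meets `A⁺` and `B⁺`.
            X : Subset (n G)
            X = ⟪ core? ⟫

            X⊆H : ∀ {x} → x ∈ X → x ∈ H
            X⊆H = proj₁ ∘ ∈⟪⟫⁻ core?

            a∈X : a ∈ X
            a∈X = ∈⟪⟫⁺ core? (a∈H , λ { (i , eq) → ℓ≢a i eq })

            b∈X : b ∈ X
            b∈X = ∈⟪⟫⁺ core? (b∈H , λ { (i , eq) → ℓ≢b i eq })

            X-conn : Conn X
            X-conn = conn-from λ x∈X → let x∈H , ¬leaf = ∈⟪⟫⁻ core? x∈X in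
              walk-map (∈⟪⟫⁺ core?) (walk-avoiding-leaves {Y = IsLeaf} (λ { (i , refl) → leaf i }) x∈H ¬leaf)

            essential : ∀ i → Essential (ℓ i)
            essential i = leaf-essential (leaf i) (ℓ≢a i) (ℓ≢b i)

            ℓ~X : ∀ i → ℓ i ~ˢ X
            ℓ~X i with leaf i
            ... | ℓ∈H , 0<δ , _ with parent-spec ℓ∈H 0<δ
            -- The parent has the child `ℓ i`, so it is none of the chosen leaves.
            ... | p∈H , p~ℓ , _ = _ , ∈⟪⟫⁺ core? (p∈H , λ { (j , eq) → proj₂ (proj₂ (leaf j)) _ ℓ∈H 0<δ (sym eq) }) , ~-sym p~ℓ

            -- A single leaf certifies that `D` touches `A` and `B`; `1≤t` supplies one.
            i₀ : Fin t
            i₀ = fromℕ< 1≤t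

            touch-A = Essential.touch-A (essential i₀)
            touch-B = Essential.touch-B (essential i₀)

            enlarge : ∀ {S S′ T T′ : Subset (n G)} → S ⊆ S′ → T ⊆ T′ → Touch S T → Touch S′ T′
            enlarge f g (x , x∈ , y , y∈ , x~y) = x , f x∈ , y , g y∈ , x~y

            A⁺B⁺ : Touch A⁺ B⁺
            A⁺B⁺ = enlarge (A⁺⁺ ∘ inj₁) (B⁺⁺ ∘ inj₁) (joined touch-A touch-B)

            XA⁺ : Touch X A⁺
            XA⁺ = enlarge id (A⁺⁺ ∘ inj₁) (a , a∈X , a~A touch-A)

            XB⁺ : Touch X B⁺
            XB⁺ = enlarge id (B⁺⁺ ∘ inj₁) (b , b∈X , b~B touch-B)

            K : Fin 3 → Subset (n G)
            K zero             = A⁺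
            K (suc zero)       = B⁺
            K (suc (suc zero)) = X

            K-nonempty : ∀ h → Nonempty (K h)
            K-nonempty zero             = let x , x∈ , _ = A⁺B⁺ in x , x∈
            K-nonempty (suc zero)       = let x , x∈ , _ = touch-sym A⁺B⁺ in x , x∈
            K-nonempty (suc (suc zero)) = a , a∈X

            K-conn : ∀ h → Conn (K h)
            K-conn zero             = A⁺-conn A-conn
            K-conn (suc zero)       = B⁺-conn B-conn
            K-conn (suc (suc zero)) = X-conn

            K-disjoint : ∀ h k {x} → x ∈ K h → x ∈ K k → h ≡ k
            K-disjoint zero zero _ _ = refl
            K-disjoint zero (suc zero) p q = contradiction q (A⁺-B⁺-disjoint p)
            K-disjoint zero (suc (suc zero)) p q = contradiction p (H∌A⁺ (X⊆H q))
            K-disjoint (suc zero) zero p q = contradiction p (A⁺-B⁺-disjoint q)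
            K-disjoint (suc zero) (suc zero) _ _ = refl
            K-disjoint (suc zero) (suc (suc zero)) p q = contradiction p (H∌B⁺ (X⊆H q))
            K-disjoint (suc (suc zero)) zero p q = contradiction q (H∌A⁺ (X⊆H p))
            K-disjoint (suc (suc zero)) (suc zero) p q = contradiction q (H∌B⁺ (X⊆H p))
            K-disjoint (suc (suc zero)) (suc (suc zero)) _ _ = refl

            K-touching : ∀ h k → h ≢ k → Touch (K h) (K k)
            K-touching zero zero h≢k = contradiction refl h≢k
            K-touching zero (suc zero) _ = A⁺B⁺
            K-touching zero (suc (suc zero)) _ = touch-sym XA⁺
            K-touching (suc zero) zero _ = touch-sym A⁺B⁺
            K-touching (suc zero) (suc zero) h≢k = contradiction refl h≢k
            K-touching (suc zero) (suc (suc zero)) _ = touch-sym XB⁺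
            K-touching (suc (suc zero)) zero _ = XA⁺
            K-touching (suc (suc zero)) (suc zero) _ = XB⁺
            K-touching (suc (suc zero)) (suc (suc zero)) h≢k = contradiction refl h≢k

            ℓ∉K : ∀ i h → ℓ i ∉ K h
            ℓ∉K i zero             = H∌A⁺ (proj₁ (leaf i))
            ℓ∉K i (suc zero)       = H∌B⁺ (proj₁ (leaf i))
            ℓ∉K i (suc (suc zero)) = λ ℓ∈X → proj₂ (∈⟪⟫⁻ core? ℓ∈X) (i , refl)

            ℓ~K : ∀ i h → ℓ i ~ˢ K h
            ℓ~K i zero             = Essential.~A⁺ (essential i)
            ℓ~K i (suc zero)       = Essential.~B⁺ (essential i)
            ℓ~K i (suc (suc zero)) = ℓ~X i

          leaves⇒minor : Minor (K3t* t) G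
          leaves⇒minor = K3t*-minor K ℓ K-nonempty K-conn K-disjoint K-touching ℓ-injective ℓ∉K ℓ~K

        -- Distinct vertices of a layer have distinct leaves below them. Of `2 + t` leaves at most
        -- two are `a` or `b`, and the other `t` yield the minor.
        layer-small : ∀ k (f : Fin (2 + t) → V) → (∀ {i j} → f i ≡ f j → i ≡ j) →
                      ¬ (∀ i → f i ∈ H × δ (f i) ≡ suc k)
        layer-small k f f-inj f∈ = choose (dodge₂ _≟_ ℓ ℓ-inj a b)
          where
          below : ∀ i → ∃ (LeafBelow (f i))
          below i = leafBelow (proj₁ (f∈ i)) (subst (0 <_) (sym (proj₂ (f∈ i))) (s≤s z≤n))

          ℓ : Fin (2 + t) → V
          ℓ i = proj₁ (below i)

          ℓ-inj : ∀ {i j} → ℓ i ≡ ℓ j → i ≡ j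
          ℓ-inj {i} {j} eq = f-inj (leafBelow-injective (trans (proj₂ (f∈ i)) (sym (proj₂ (f∈ j))))
            (proj₂ (below i)) (subst (LeafBelow (f j)) (sym eq) (proj₂ (below j))))

          choose : ¬ ∃ λ (σ : Fin t → Fin (2 + t)) → (∀ {i j} → σ i ≡ σ j → i ≡ j) × (∀ i → ℓ (σ i) ≢ a) × (∀ i → ℓ (σ i) ≢ b)
          choose (σ , σ-inj , ≢a , ≢b) = minor-free (leaves⇒minor (λ i → ℓ (σ i)) (λ eq → σ-inj (ℓ-inj eq))
            (λ i → proj₁ (proj₂ (below (σ i)))) ≢a ≢b)

      thin : ∀ {r} (r∈H : r ∈ H) k {xs} → Unique xs →
             All (λ x → x ∈ H × BFS.δ G H-conn r∈H x ≡ suc k) xs → length xs ≤ suc t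
      thin r∈H k {xs} uniq all = decidable-stable (length xs ≤? suc t) λ ≰ →
        let 2+t≤ = ≰⇒> ≰ in
        layer-small r∈H k (λ i → List.lookup xs (inject≤ i 2+t≤))
          (λ eq → Fin.inject≤-injective 2+t≤ 2+t≤ _ _ (lookup-injective uniq eq))
          (λ i → All.lookup all (∈-lookup (inject≤ i 2+t≤)))

    minimal⇒piece : Piece D A B
    minimal⇒piece = record
      { H = H ; H⊆D = H⊆D ; root = a ; root∈ = a∈H ; H-conn = H-conn
      ; meets-A   = λ touch → a , a∈H , a~A touch
      ; meets-B   = λ touch → b , b∈H , b~B touch
      ; separates = ¬leak
      ; thin      = thin
      }

  piece : ∀ {D A B} → Frame D A B → Conn D → Nonempty D → Piece D A B
  piece {D} {A} {B} frame D-conn (v , v∈D) = fromTerminals (terminal A) (terminal B)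
    where
    terminal : ∀ S → ∃ λ a → a ∈ D × (Touch D S → a ~ˢ S)
    terminal S with touch? D S
    ... | yes (a , a∈D , a~S) = a , a∈D , λ _ → a~S
    -- Without contact any vertex of `D` will do, as the promise is vacuous.
    ... | no ¬touch           = v , v∈D , λ touch → contradiction touch ¬touch

    fromTerminals : (∃ λ a → a ∈ D × (Touch D A → a ~ˢ A)) → (∃ λ b → b ∈ D × (Touch D B → b ~ˢ B)) → Piece D A B
    fromTerminals (a , a∈D , a~A) (b , b∈D , b~B) with minimal-subset good? D D-good
      where
      Good : Subset (n G) → Set
      Good T = (a ∈ T × b ∈ T) × (∀ x → x ∈ T → Walk G (_∈ T) x a) × ¬ Leak D A B T

      good? : Decidable Good
      good? T = ((a ∈? T) ×-dec (b ∈? T)) ×-dec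
                (all? (λ x → (x ∈? T) →-dec walk? (_∈? T) x a) ×-dec ¬? (leak? D A B T))

      D-good : Good D
      -- `D` qualifies: no vertex of `D` lies outside `D`, so nothing can leak.
      D-good = (a∈D , b∈D) , (λ x x∈D → D-conn x∈D a∈D) ,
               λ { (_ , _ , _ , w) → proj₂ (walk-start w) (proj₁ (walk-start w)) }
    ... | H , H⊆D , ((a∈H , b∈H) , toA , tight) , minimal =
      Minimal.minimal⇒piece frame H⊆D (conn-from (toA _)) a∈H b∈H a~A b~B tight
        -- `H - ℓ` still contains `a` and `b` and is connected, so by minimality it can only fail by
        -- leaking.
        λ {ℓ} ℓ∈H ℓ≢a ℓ≢b conn → decidable-stable (leak? D A B (H - ℓ)) λ ¬leak →
          let a∈ = x∈p∧x≢y⇒x∈p-y a∈H (ℓ≢a ∘ sym)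
          in minimal ℓ ℓ∈H ((a∈ , x∈p∧x≢y⇒x∈p-y b∈H (ℓ≢b ∘ sym)) , (λ x x∈ → conn x∈ a∈) , ¬leak)

-- Colourings and their gluing

parity : ℕ → Fin 2
parity zero    = zero
parity (suc m) = opposite (parity m)

opposite-injective : ∀ {m} {i j : Fin m} → opposite i ≡ opposite j → i ≡ j
opposite-injective {i = i} {j} eq =
  trans (sym (Fin.opposite-involutive i)) (trans (cong opposite eq) (Fin.opposite-involutive j))

-- Layers of adjacent vertices differ by at most one, so equal parity forces equal layers.
parity-injective : ∀ {m k} → m ≤ suc k → k ≤ suc m → parity m ≡ parity k → m ≡ k
parity-injective {zero}  {zero}        _ _ _  = refl
parity-injective {zero}  {suc zero}    _ _ ()
parity-injective {zero}  {suc (suc _)} _ (s≤s ()) _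
parity-injective {suc zero}    {zero}  _ _ ()
parity-injective {suc (suc _)} {zero}  (s≤s ()) _ _
parity-injective {suc m} {suc k} (s≤s p) (s≤s q) eq = cong suc (parity-injective p q (opposite-injective eq))

thirdColour : ∀ (α β : Fin 3) → ∃ λ γ → γ ≢ α × γ ≢ β
thirdColour = from-yes (all? {n = 3} λ α → all? {n = 3} λ β → any? λ γ → ¬? (γ ≟ α) ×-dec ¬? (γ ≟ β))

length-const : ∀ {A : Set} {r : A} {xs} → Unique xs → All (_≡ r) xs → length xs ≤ 1
length-const {xs = []}        _ _ = z≤n
length-const {xs = _ ∷ []}    _ _ = s≤s z≤n
length-const {xs = _ ∷ _ ∷ _} ((x≢y ∷ _) ∷ _) (refl ∷ refl ∷ _) = contradiction refl x≢y

module Colourings (G : Graph) (s : ℕ) where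
  open Walks G

  SmallDegree : Subset (n G) → (V → Fin 3) → V → Set
  SmallDegree C κ x = ∀ {xs} → Unique xs → All (λ u → u ∈ C × x ~ u × κ u ≡ κ x) xs → length xs ≤ s

  SmallCluster : Subset (n G) → (V → Fin 3) → (V → Fin 2) → V → Set
  SmallCluster C κ π x = ∀ {xs} → Unique xs →
    All (Walk G (λ w → w ∈ C × κ w ≡ κ x × π w ≡ π x) x) xs → length xs ≤ s

  -- One colouring serves both claims: `κ` alone gives the defect, and the bit `π` splits each
  -- colour in two for the clustering.
  record Colouring (C : Subset (n G)) (Ok : V → Fin 3 → Set) : Set where
    field
      κ       : V → Fin 3
      π       : V → Fin 2
      ok      : ∀ {x} → x ∈ C → Ok x (κ x)
      degree  : ∀ {x} → x ∈ C → SmallDegree C κ x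
      cluster : ∀ {x} → x ∈ C → SmallCluster C κ π x

  empty-colouring : ∀ {C Ok} → ¬ Nonempty C → Colouring C Ok
  empty-colouring ¬ne = record
    { κ = λ _ → zero ; π = λ _ → zero
    ; ok = λ x∈ → contradiction (_ , x∈) ¬ne
    ; degree = λ x∈ → contradiction (_ , x∈) ¬ne
    ; cluster = λ x∈ → contradiction (_ , x∈) ¬ne
    }

  module _ {X C : Subset (n G)} {κ κ′ : V → Fin 3} {π π′ : V → Fin 2}
    (κ≗ : ∀ {x} → x ∈ X → κ x ≡ κ′ x) (π≗ : ∀ {x} → x ∈ X → π x ≡ π′ x)
    (closed : ∀ {x y} → x ∈ X → y ∈ C → x ~ y → κ x ≡ κ y → y ∈ X) where

    smallDegree-extend : ∀ {x} → x ∈ X → SmallDegree X κ′ x → SmallDegree C κ x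
    smallDegree-extend x∈ small uniq all = small uniq (All.map f all)
      where
      f : ∀ {u} → u ∈ C × _ ~ u × κ u ≡ κ _ → u ∈ X × _ ~ u × κ′ u ≡ κ′ _
      f (u∈ , x~u , eq) = let u∈X = closed x∈ u∈ x~u (sym eq) in
        u∈X , x~u , trans (sym (κ≗ u∈X)) (trans eq (κ≗ x∈))

    -- By `closed`, no edge of a walk within the colour class of `x` leaves `X`, so the cluster of
    -- `x` is already a cluster of `X`.
    smallCluster-extend : ∀ {x} → x ∈ X → SmallCluster X κ′ π′ x → SmallCluster C κ π x
    smallCluster-extend {x} x∈ small uniq all =
      small uniq (All.map (walk-invariant stay (x∈ , refl , refl)) all)
      where
      stay : ∀ {u v} → u ∈ X × κ′ u ≡ κ′ x × π′ u ≡ π′ x → v ∈ C × κ v ≡ κ x × π v ≡ π x → u ~ v →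
             v ∈ X × κ′ v ≡ κ′ x × π′ v ≡ π′ x
      stay (u∈ , κu , _) (v∈ , κv , πv) u~v =
        v∈X , trans (sym (κ≗ v∈X)) (trans κv (κ≗ x∈)) , trans (sym (π≗ v∈X)) (trans πv (π≗ x∈))
        where
        v∈X = closed u∈ v∈ u~v (trans (κ≗ u∈) (trans κu (trans (sym (κ≗ x∈)) (sym κv))))

  module _ {X Y C : Subset (n G)} {Ok₁ Ok₂ Ok : V → Fin 3 → Set}
    (split : ∀ {x} → x ∈ C → x ∈ X ⊎ x ∈ Y) (Y∌X : ∀ {x} → x ∈ Y → x ∉ X)
    (weaken₁ : ∀ {x c} → x ∈ X → Ok₁ x c → Ok x c) (weaken₂ : ∀ {x c} → x ∈ Y → Ok₂ x c → Ok x c)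
    (apart : ∀ {x y c} → x ∈ X → y ∈ Y → x ~ y → Ok₁ x c → ¬ Ok₂ y c) where

    -- By `apart` no edge between `X` and `Y` is monochromatic, so each side is closed under
    -- monochromatic edges and keeps its bounds.
    union-colouring : Colouring X Ok₁ → Colouring Y Ok₂ → Colouring C Ok
    union-colouring c₁ c₂ = record
      { κ = κ ; π = π
      ; ok = λ x∈ → ok (split x∈)
      ; degree = λ x∈ → degree (split x∈)
      ; cluster = λ x∈ → cluster (split x∈)
      }
      where
      module ₁ = Colouring c₁
      module ₂ = Colouring c₂

      choose : ∀ {A : Set} → (V → A) → (V → A) → V → A
      choose f g x with x ∈? X
      ... | yes _ = f x
      ... | no _  = g x

      choose-X : ∀ {A : Set} (f g : V → A) {x} → x ∈ X → choose f g x ≡ f x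
      choose-X f g {x} x∈ with x ∈? X
      ... | yes _ = refl
      ... | no x∉ = contradiction x∈ x∉

      choose-Y : ∀ {A : Set} (f g : V → A) {x} → x ∈ Y → choose f g x ≡ g x
      choose-Y f g {x} x∈ with x ∈? X
      ... | yes x∈X = contradiction x∈X (Y∌X x∈)
      ... | no _    = refl

      κ = choose ₁.κ ₂.κ
      π = choose ₁.π ₂.π

      clash : ∀ {x y} → x ∈ X → y ∈ Y → x ~ y → κ x ≢ κ y
      clash {x} {y} x∈ y∈ x~y eq = apart x∈ y∈ x~y (₁.ok x∈)
        (subst (Ok₂ y) (trans (sym (choose-Y ₁.κ ₂.κ y∈)) (trans (sym eq) (choose-X ₁.κ ₂.κ x∈))) (₂.ok y∈))

      closed-X : ∀ {x y} → x ∈ X → y ∈ C → x ~ y → κ x ≡ κ y → y ∈ X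
      closed-X x∈ y∈ x~y eq with split y∈
      ... | inj₁ y∈X = y∈X
      ... | inj₂ y∈Y = contradiction eq (clash x∈ y∈Y x~y)

      closed-Y : ∀ {x y} → x ∈ Y → y ∈ C → x ~ y → κ x ≡ κ y → y ∈ Y
      closed-Y x∈ y∈ x~y eq with split y∈
      ... | inj₁ y∈X = contradiction (sym eq) (clash y∈X x∈ (~-sym x~y))
      ... | inj₂ y∈Y = y∈Y

      ok : ∀ {x} → x ∈ X ⊎ x ∈ Y → Ok x (κ x)
      ok (inj₁ x∈) = subst (Ok _) (sym (choose-X ₁.κ ₂.κ x∈)) (weaken₁ x∈ (₁.ok x∈))
      ok (inj₂ x∈) = subst (Ok _) (sym (choose-Y ₁.κ ₂.κ x∈)) (weaken₂ x∈ (₂.ok x∈))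

      degree : ∀ {x} → x ∈ X ⊎ x ∈ Y → SmallDegree C κ x
      degree (inj₁ x∈) = smallDegree-extend {π = π} {₁.π} (choose-X _ _) (choose-X _ _) closed-X x∈ (₁.degree x∈)
      degree (inj₂ x∈) = smallDegree-extend {π = π} {₂.π} (choose-Y _ _) (choose-Y _ _) closed-Y x∈ (₂.degree x∈)

      cluster : ∀ {x} → x ∈ X ⊎ x ∈ Y → SmallCluster C κ π x
      cluster (inj₁ x∈) = smallCluster-extend (choose-X _ _) (choose-X _ _) closed-X x∈ (₁.cluster x∈)
      cluster (inj₂ x∈) = smallCluster-extend (choose-Y _ _) (choose-Y _ _) closed-Y x∈ (₂.cluster x∈)

-- Recursion on the uncoloured set

module Recursion (G : Graph) {t : ℕ} (1≤t : 1 ≤ t) (minor-free : ¬ Minor (K3t* t) G) where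
  open Walks G
  open Pieces G 1≤t minor-free
  open Colourings G (suc t)

  frame-restrict : ∀ {C D A B} → D ⊆ C → Frame C A B → Frame D A B
  frame-restrict D⊆C F = record
    { A-conn = A-conn ; B-conn = B-conn ; A∌B = A∌B ; C∌A = C∌A ∘ D⊆C ; C∌B = C∌B ∘ D⊆C
    ; joined = λ { (x , x∈ , x~A) (y , y∈ , y~B) → joined (x , D⊆C x∈ , x~A) (y , D⊆C y∈ , y~B) } }
    where open Frame F

  piece-colouring : ∀ {D A B} (P : Piece D A B) γ → Colouring (Piece.H P) (λ _ c → c ≡ γ)
  piece-colouring P γ = record
    { κ = λ _ → γ ; π = parity ∘ δ ; ok = λ _ → refl ; degree = degree ; cluster = cluster }
    where
    open Piece P
    open BFS G H-conn root∈

    degree : ∀ {x} → x ∈ H → SmallDegree H (λ _ → γ) x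
    degree {x} x∈ uniq all = thin x∈ 0 uniq (All.map f all)
      where
      module X = BFS G H-conn x∈

      f : ∀ {u} → u ∈ H × x ~ u × γ ≡ γ → u ∈ H × X.δ u ≡ 1
      f {u} (u∈ , x~u , _) = u∈ , ≤-antisym
        -- A neighbour of `x` has distance at most 1 from it, and not 0 as there are no loops.
        (subst (λ k → X.δ u ≤ suc k) X.δ-root (X.δ-step x∈ u∈ x~u))
        (ℕ.n≢0⇒n>0 λ δ≡0 → ~-irrefl (subst (x ~_) (X.δ≡0⇒root u∈ δ≡0) x~u))

    cluster : ∀ {x} → x ∈ H → SmallCluster H (λ _ → γ) (parity ∘ δ) x
    cluster {x} x∈ {xs} uniq all = bound (δ x) (All.map (λ w → walk-end (walk-invariant stay (x∈ , refl) w)) all)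
      where
      stay : ∀ {u v} → u ∈ H × δ u ≡ δ x → v ∈ H × γ ≡ γ × parity (δ v) ≡ parity (δ x) → u ~ v → v ∈ H × δ v ≡ δ x
      stay (u∈ , δu) (v∈ , _ , πv) u~v = v∈ ,
        parity-injective (subst (λ k → _ ≤ suc k) δu (δ-step u∈ v∈ u~v))
          (subst (_≤ suc _) δu (δ-step v∈ u∈ (~-sym u~v))) πv

      bound : ∀ k → All (λ u → u ∈ H × δ u ≡ k) xs → length xs ≤ suc t
      -- `thin` covers only positive layers; layer 0 is the root alone.
      bound zero    all = ≤-trans (length-const uniq (All.map (λ { (u∈ , δu) → δ≡0⇒root u∈ δu }) all)) (s≤s z≤n)
      bound (suc k) all = thin root∈ k uniq all

  Allowed : Subset (n G) → Fin 3 → Subset (n G) → Fin 3 → V → Fin 3 → Set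
  Allowed A α B β x c = (x ~ˢ A → c ≢ α) × (x ~ˢ B → c ≢ β)

  -- Quantified over all pairs of sets, since the recursive calls use `A` with `H`, `B` with `H`,
  -- and `A` with `B`.
  Colourable : Subset (n G) → Set
  Colourable C = ∀ {A B} α β → Frame C A B → Colouring C (Allowed A α B β)

  module Step {C : Subset (n G)} (smaller : ∀ {D} → D ⊂ C → Colourable D) {A B} {α β γ : Fin 3}
    (γ≢α : γ ≢ α) (γ≢β : γ ≢ β) (F : Frame C A B) {D : Subset (n G)} (D⊆C : D ⊆ C)
    (D-closed : ∀ {x y} → x ∈ D → y ∈ C → x ~ y → y ∈ D) (P : Piece D A B) where
    open Frame F
    open Piece P

    out? : Decidable (Outside D H)
    out? = outside? D H

    open Halo G out? B

    nearB? : Decidable (λ z → Outside D H z × z ∈ halo)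
    nearB? z = out? z ×-dec (z ∈? halo)

    rest? : Decidable (λ z → Outside D H z × z ∉ halo)
    rest? z = out? z ×-dec ¬? (z ∈? halo)

    other? : Decidable (Outside C D)
    other? = outside? C D

    -- `K_B` collects the components of `D − H` adjacent to `B`; `K_A` takes all others, including
    -- those adjacent to neither set.
    R K_A K_B E : Subset (n G)
    R = ⟪ out? ⟫
    K_A = ⟪ rest? ⟫
    K_B = ⟪ nearB? ⟫
    E = ⟪ other? ⟫

    K_A-out : ∀ {x} → x ∈ K_A → Outside D H x
    K_A-out = proj₁ ∘ ∈⟪⟫⁻ rest?

    K_B-out : ∀ {x} → x ∈ K_B → Outside D H x
    K_B-out = proj₁ ∘ ∈⟪⟫⁻ nearB?

    touch-mono : ∀ {S S′ T} → S ⊆ S′ → Touch S T → Touch S′ T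
    touch-mono S⊆ (x , x∈ , x~) = x , S⊆ x∈ , x~

    root∈C : root ∈ C
    root∈C = D⊆C (H⊆D root∈)

    -- `K_A` sees only `A` and `H`, and is smaller than `C` because it lacks `root`.
    colour-A : Colouring K_A (Allowed A α H γ)
    colour-A = smaller ((λ x∈ → D⊆C (proj₁ (K_A-out x∈))) , root , root∈C , λ r∈ → proj₂ (K_A-out r∈) root∈) α γ record
      { A-conn = A-conn ; B-conn = H-conn
      ; A∌B    = λ x∈A x∈H → C∌A (D⊆C (H⊆D x∈H)) x∈A
      ; C∌A    = λ x∈ → C∌A (D⊆C (proj₁ (K_A-out x∈)))
      ; C∌B    = λ x∈ → proj₂ (K_A-out x∈)
      -- If `K_A` touches `A`, so does `D`, and then `H` does through its fixed vertex.
      ; joined = λ touch _ → touch-sym (meets-A (touch-mono (λ x∈ → proj₁ (K_A-out x∈)) touch)) }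

    colour-B : Colouring K_B (Allowed B β H γ)
    colour-B = smaller ((λ x∈ → D⊆C (proj₁ (K_B-out x∈))) , root , root∈C , λ r∈ → proj₂ (K_B-out r∈) root∈) β γ record
      { A-conn = B-conn ; B-conn = H-conn
      ; A∌B    = λ x∈B x∈H → C∌B (D⊆C (H⊆D x∈H)) x∈B
      ; C∌A    = λ x∈ → C∌B (D⊆C (proj₁ (K_B-out x∈)))
      ; C∌B    = λ x∈ → proj₂ (K_B-out x∈)
      ; joined = λ touch _ → touch-sym (meets-B (touch-mono (λ x∈ → proj₁ (K_B-out x∈)) touch)) }

    colour-E : Colouring E (Allowed A α B β)
    colour-E = smaller ((λ x∈ → proj₁ (∈⟪⟫⁻ other? x∈)) , root , root∈C , λ r∈E → proj₂ (∈⟪⟫⁻ other? r∈E) (H⊆D root∈)) α β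
      (frame-restrict (λ x∈ → proj₁ (∈⟪⟫⁻ other? x∈)) F)

    K_A-avoids-B : ∀ {x} → x ∈ K_A → ¬ (x ~ˢ B)
    K_A-avoids-B x∈ (y , y∈B , x~y) = let out , x∉ = ∈⟪⟫⁻ rest? x∈ in
      x∉ (halo-closed out (y , halo⁺ (inj₁ y∈B) , x~y))

    K_B-avoids-A : ∀ {x} → x ∈ K_B → ¬ (x ~ˢ A)
    K_B-avoids-A x∈ x~A with ∈⟪⟫⁻ nearB? x∈
    ... | (x∈D , _) , x∈halo with halo⁻ x∈halo
    ... | inj₁ x∈B             = C∌B (D⊆C x∈D) x∈B
    ... | inj₂ (_ , y~B , w) = separates x~A y~B (walk-sym w)

    colour-R : Colouring R (λ x c → Allowed A α B β x c × (x ~ˢ H → c ≢ γ))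
    colour-R = union-colouring {X = K_A} {K_B}
      (λ {x} x∈ → split (∈⟪⟫⁻ out? x∈) (x ∈? halo))
      (λ x∈B x∈A → proj₂ (∈⟪⟫⁻ rest? x∈A) (proj₂ (∈⟪⟫⁻ nearB? x∈B)))
      (λ x∈ (avA , avH) → (avA , λ x~B → contradiction x~B (K_A-avoids-B x∈)) , avH)
      (λ x∈ (avB , avH) → ((λ x~A → contradiction x~A (K_B-avoids-A x∈)) , avB) , avH)
      -- No edge joins `K_A` to `K_B`: the halo would absorb its end in `K_A`.
      (λ x∈ y∈ x~y _ _ → let out , x∉ = ∈⟪⟫⁻ rest? x∈ in
        x∉ (halo-closed out (_ , proj₂ (∈⟪⟫⁻ nearB? y∈) , x~y)))
      colour-A colour-B
      where
      split : ∀ {x} → Outside D H x → Dec (x ∈ halo) → x ∈ K_A ⊎ x ∈ K_B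
      split out (yes x∈) = inj₂ (∈⟪⟫⁺ nearB? (out , x∈))
      split out (no x∉)  = inj₁ (∈⟪⟫⁺ rest? (out , x∉))

    colour-D : Colouring D (Allowed A α B β)
    colour-D = union-colouring {X = H} {R}
      (λ {x} x∈ → split x∈ (x ∈? H))
      (λ x∈R → proj₂ (∈⟪⟫⁻ out? x∈R))
      (λ { _ refl → (λ _ → γ≢α) , λ _ → γ≢β })
      (λ _ → proj₁)
      -- `H` is coloured `γ` throughout, and its neighbours in `R` avoid `γ`.
      (λ { x∈ y∈ x~y c≡γ (_ , avH) → avH (_ , x∈ , ~-sym x~y) c≡γ })
      (piece-colouring P γ) colour-R
      where
      split : ∀ {x} → x ∈ D → Dec (x ∈ H) → x ∈ H ⊎ x ∈ R
      split x∈ (yes x∈H) = inj₁ x∈H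
      split x∈ (no x∉H)  = inj₂ (∈⟪⟫⁺ out? (x∈ , x∉H))

    colour-C : Colouring C (Allowed A α B β)
    colour-C = union-colouring {X = D} {E}
      (λ {x} x∈ → split x∈ (x ∈? D))
      (λ x∈E → proj₂ (∈⟪⟫⁻ other? x∈E))
      (λ _ → id) (λ _ → id)
      (λ x∈ y∈ x~y _ _ → let y∈C , y∉D = ∈⟪⟫⁻ other? y∈ in y∉D (D-closed x∈ y∈C x~y))
      colour-D colour-E
      where
      split : ∀ {x} → x ∈ C → Dec (x ∈ D) → x ∈ D ⊎ x ∈ E
      split x∈ (yes x∈D) = inj₁ x∈D
      split x∈ (no x∉D)  = inj₂ (∈⟪⟫⁺ other? (x∈ , x∉D))

  module Component {C : Subset (n G)} {v : V} (v∈C : v ∈ C) where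

    private
      component? : Decidable (Walk G (_∈ C) v)
      component? = walk? (_∈? C) v

    component : Subset (n G)
    component = ⟪ component? ⟫

    component-⊆ : component ⊆ C
    component-⊆ x∈ = walk-end (∈⟪⟫⁻ component? x∈)

    component-closed : ∀ {x y} → x ∈ component → y ∈ C → x ~ y → y ∈ component
    component-closed x∈ y∈ x~y = ∈⟪⟫⁺ component? (walk-snoc (∈⟪⟫⁻ component? x∈) x~y y∈)

    ∈-component : v ∈ component
    ∈-component = ∈⟪⟫⁺ component? (here v∈C)

    component-conn : Conn component
    component-conn = conn-from λ x∈ →
      walk-sym (walk-invariant component-closed ∈-component (∈⟪⟫⁻ component? x∈))

  colourable : ∀ C → Colourable C
  colourable C = go C (⊂-wellFounded C)
    where
    go : ∀ C → Acc _⊂_ C → Colourable C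
    go C (acc rs) α β F with nonempty? C
    ... | no ¬ne        = empty-colouring ¬ne
    ... | yes (v , v∈C) with thirdColour α β
    ... | γ , γ≢α , γ≢β = Step.colour-C (λ {D} D⊂C → go D (rs D⊂C)) γ≢α γ≢β F component-⊆ component-closed
      (piece (frame-restrict component-⊆ F) component-conn (v , ∈-component))
      where open Component v∈C

-- The two bounds

theorem17 : (t : ℕ) → 1 ≤ t → (G : Graph) → ¬ Minor (K3t* t) G →
    DefectColourable G 3 (4 * t) × ClusterColourable G 6 (2 * t)
theorem17 t 1≤t G minor-free = (κ , defect) , (λ v → combine (κ v) (π v)) , clustering
  where
  open Walks G
  open Pieces G 1≤t minor-free
  open Colourings G (suc t)
  open Recursion G 1≤t minor-free

  -- The recursion starts with `A` and `B` empty, where every condition is vacuous and the initial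
  -- colours forbid nothing.
  nothing-between : Frame ⊤ ⊥ ⊥
  nothing-between = record
    { A-conn = λ x∈ → contradiction x∈ ∉⊥ ; B-conn = λ x∈ → contradiction x∈ ∉⊥
    ; A∌B = λ _ → ∉⊥ ; C∌A = λ _ → ∉⊥ ; C∌B = λ _ → ∉⊥
    ; joined = λ { (_ , _ , _ , y∈ , _) → contradiction y∈ ∉⊥ } }

  open Colouring (colourable ⊤ zero zero nothing-between)

  -- Both bounds obtained are `suc t`; `1≤t` turns them into the stated multiples of `t`.
  1+t≤2*t : suc t ≤ 2 * t
  1+t≤2*t = +-mono-≤ 1≤t (≤-reflexive (sym (+-identityʳ t)))

  defect : ∀ v → length (filterᵇ (λ u → adj G v u ∧ eqb (κ u) (κ v)) (allFin (n G))) ≤ 4 * t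
  defect v = ≤-trans (degree (∈⊤ {x = v}) (filter⁺ _ (allFin⁺ (n G))) (All.map f (all-filter _ (allFin (n G)))))
    (≤-trans 1+t≤2*t (*-monoˡ-≤ t {2} {4} (s≤s (s≤s z≤n))))
    where
    f : ∀ {u} → T (adj G v u ∧ eqb (κ u) (κ v)) → u ∈ ⊤ × v ~ u × κ u ≡ κ v
    f {u} p = let v~u , same = Equivalence.to Bool.T-∧ p in
      ∈⊤ , Equivalence.to Bool.T-≡ v~u , toWitness same

  -- `combine` is injective, so sharing one of the six colours means agreeing in both `κ` and `π`.
  clustering : ∀ v xs → Unique xs → All (Walk G (λ w → combine (κ w) (π w) ≡ combine (κ v) (π v)) v) xs → length xs ≤ 2 * t
  clustering v xs uniq all = ≤-trans
    (cluster (∈⊤ {x = v}) uniq (All.map (walk-map λ {w} eq → ∈⊤ , Fin.combine-injective (κ w) (π w) (κ v) (π v) eq) all))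
    1+t≤2*t
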